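{- There exists a family of $n$-bit communication problems $F_n:\{0,1\}^n\times\{0,1\}^n\to\{0,1\}$ with $\mathsf{PP}(F_n)=O(\log n)$ and $\mathrm{rect}(F_n)^{ -1}=2^{\Omega(n)}$. In particular, $\mathsf{D}^{\mathsf{NP}}(F_n)=\Omega(n)$, and the communication class $\mathsf{PP}$ is not contained in the communication class $\mathsf{P}^{\mathsf{NP}}$.
   Context: For a Boolean matrix $F\in\{0,1\}^{\mathcal X\times\mathcal Y}$: a monochromatic rectangle is a set $S\times T$ ($S\subseteq\mathcal X,T\subseteq\mathcal Y$) on which $F$ is constant, and $\mathrm{rect}(F)=\max_R |R|/|\mathcal X\times\mathcal Y|$ over monochromatic rectangles $R$. A deterministic protocol is a binary tree whose internal nodes are owned by Alice (labelled by a function of $x$ into $\{0,1\}$) or Bob (a function of $y$); the leaf reached on $(x,y)$ gives the output; cost is the height. A nondeterministic protocol is a family of deterministic protocols $\pi_a$ indexed by advice strings $a\in\{0,1\}^k$, computing $F$ if $F(x,y)=1\iff\exists a:\pi_a(x,y)=1$, with cost $k$ plus the maximum cost of the $\pi_a$; $\mathsf{N}(F)$ is the minimum such cost. An oracle protocol is a deterministic protocol tree in which some internal nodes $v$ are instead labelled by a triple $(P_v,a_v,b_v)$, where $P_v$ is a Boolean matrix on some $\mathcal X'\times\mathcal Y'$, $a_v:\mathcal X\to\mathcal X'$, $b_v:\mathcal Y\to\mathcal Y'$, and the branch taken at $v$ is $P_v(a_v(x),b_v(y))$. The $\mathsf{D}^{\mathsf{NP}}$ cost of a root-to-leaf path is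 the number of communicated bits on it plus $\sum_v \mathsf{N}(P_v)$ over oracle nodes $v$ on it; the cost of the protocol is the maximum over paths, and $\mathsf{D}^{\mathsf{NP}}(F)$ is the minimum cost of an oracle protocol computing $F$. A public-coin randomized protocol is a probability distribution over deterministic protocols (chosen using shared randomness), with cost the maximum cost of the protocols in the support; $\mathsf{R}_\epsilon(F)$ is the minimum cost of such a protocol whose output differs from $F(x,y)$ with probability at most $\epsilon$ for every input $(x,y)$. Define $\mathsf{PP}(F)=\min_{\epsilon<1/2}\big(\mathsf{R}_\epsilon(F)+\log_2\frac{1}{1/2-\epsilon}\big)$. The class $\mathsf{PP}$ (resp. $\mathsf{P}^{\mathsf{NP}}$) consists of families of $n$-bit problems $F_n$ (matrices with $\lceil\log_2\max(|\mathcal X|,|\mathcal Y|)\rceil=n$) with $\mathsf{PP}(F_n)$ (resp. $\mathsf{D}^{\mathsf{NP}}(F_n)$) bounded by a polylogarithmic function of $n$. -}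

module Defs where

open import Algebra.Properties.CommutativeMonoid.Sum using (sum)
open import Data.Bool using (Bool; true; false; if_then_else_)
import Data.Bool.Properties as Bool
open import Data.Fin using (Fin; zero)
open import Data.Fin.Properties using (2↔Bool; *↔×)
open import Data.Fin.Subset using (Subset; _∈_; ∣_∣)
import Data.Integer as ℤ
open import Data.Nat using (ℕ; zero; suc; _+_; _*_; _^_; _⊔_; _≤_)
open import Data.Nat.Logarithm using (⌊log₂_⌋; ⌈log₂_⌉)
open import Data.Product using (_×_; ∃; ∃-syntax; uncurry)
open import Data.Product.Function.NonDependent.Propositional using (_×-↔_)
open import Data.Rational as ℚ using (ℚ; 0ℚ; 1ℚ; ½)
open import Data.Rational.Properties using (+-0-commutativeMonoid)
open import Data.Vec using (Vec; []; _∷_; uncons)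
open import Function using (_⇔_; _↔_; mk↔ₛ′; Inverse)
open import Function.Properties.Inverse using (↔-sym; ↔-trans)
open import Relation.Binary.PropositionalEquality using (_≡_; refl)
open import Relation.Nullary.Decidable using (does)

------------------------------------------------------------------------
-- Finite sets and Boolean matrices

record FiniteSet : Set₁ where
  field
    Carrier : Set
    size    : ℕ
    enum    : Carrier ↔ Fin size

  index : Carrier → Fin size
  index = Inverse.to enum

open FiniteSet public using (Carrier; size; index)

Matrix : Set → Set → Set
Matrix X Y = X → Y → Bool

Vec-Bool↔Fin : ∀ n → Vec Bool n ↔ Fin (2 ^ n)
Vec-Bool↔Fin zero    = mk↔ₛ′ (λ _ → zero) (λ _ → []) (λ { zero → refl }) (λ { [] → refl })
Vec-Bool↔Fin (suc n) =
  ↔-trans (mk↔ₛ′ uncons (uncurry _∷_) (λ _ → refl) (λ { (_ ∷ _) → refl }))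
  (↔-trans (↔-sym 2↔Bool ×-↔ Vec-Bool↔Fin n) (↔-sym *↔×))

Bits : ℕ → FiniteSet
Bits n = record { Carrier = Vec Bool n ; size = 2 ^ n ; enum = Vec-Bool↔Fin n }

------------------------------------------------------------------------
-- Monochromatic rectangles

Monochromatic : (X Y : FiniteSet) → Matrix (Carrier X) (Carrier Y) →
                Subset (size X) → Subset (size Y) → Set
Monochromatic X Y F S T =
  ∃[ z ] ∀ x y → index X x ∈ S → index Y y ∈ T → F x y ≡ z

-- rect(F)⁻¹ ≥ 2^(n / K), that is, 2^n · (|S × T| / |X × Y|)^K ≤ 1 for every
-- monochromatic rectangle S × T, with denominators cleared.
2^[_/_]≤rect⁻¹ : ℕ → ℕ → ∀ {X Y} → Matrix (Carrier X) (Carrier Y) → Set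
2^[_/_]≤rect⁻¹ n K {X} {Y} F =
  ∀ S T → Monochromatic X Y F S T →
  2 ^ n * (∣ S ∣ * ∣ T ∣) ^ K ≤ (size X * size Y) ^ K

------------------------------------------------------------------------
-- Deterministic protocols

-- At internal nodes the first subtree is the branch for 0, the second for 1.
data Protocol (X Y : Set) : Set where
  leaf  : Bool → Protocol X Y
  alice : (X → Bool) → Protocol X Y → Protocol X Y → Protocol X Y
  bob   : (Y → Bool) → Protocol X Y → Protocol X Y → Protocol X Y

run : ∀ {X Y} → Protocol X Y → Matrix X Y
run (leaf z)        x y = z
run (alice f π₀ π₁) x y = if f x then run π₁ x y else run π₀ x y
run (bob   g π₀ π₁) x y = if g y then run π₁ x y else run π₀ x y

height : ∀ {X Y} → Protocol X Y → ℕ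
height (leaf _)        = 0
height (alice _ π₀ π₁) = suc (height π₀ ⊔ height π₁)
height (bob   _ π₀ π₁) = suc (height π₀ ⊔ height π₁)

-- The complexity measures below are minima over protocols.  They are given
-- through their upper bounds: "measure ≤ c" means that some protocol has cost
-- at most c.

------------------------------------------------------------------------
-- Nondeterministic protocols

record NProtocol (X Y : Set) : Set where
  field
    adviceLength : ℕ
    protocol     : Vec Bool adviceLength → Protocol X Y

  Computes : Matrix X Y → Set
  Computes F = ∀ x y → F x y ≡ true ⇔ (∃[ a ] run (protocol a) x y ≡ true)

  Cost≤ : ℕ → Set
  Cost≤ c = ∀ a → adviceLength + height (protocol a) ≤ c

N[_]≤_ : ∀ {X Y} → Matrix X Y → ℕ → Set
N[_]≤_ {X} {Y} F c = ∃ λ (π : NProtocol X Y) → NProtocol.Computes π F × NProtocol.Cost≤ π c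

------------------------------------------------------------------------
-- Oracle protocols

-- Query matrices are indexed by Fin p and Fin q; relabelling the rows and
-- columns of a finite matrix does not affect its nondeterministic complexity.
data OracleProtocol (X Y : Set) : Set where
  leaf   : Bool → OracleProtocol X Y
  alice  : (X → Bool) → OracleProtocol X Y → OracleProtocol X Y → OracleProtocol X Y
  bob    : (Y → Bool) → OracleProtocol X Y → OracleProtocol X Y → OracleProtocol X Y
  oracle : ∀ {p q} → Matrix (Fin p) (Fin q) → (X → Fin p) → (Y → Fin q) →
           OracleProtocol X Y → OracleProtocol X Y → OracleProtocol X Y

runᴼ : ∀ {X Y} → OracleProtocol X Y → Matrix X Y
runᴼ (leaf z)             x y = z
runᴼ (alice f π₀ π₁)      x y = if f x then runᴼ π₁ x y else runᴼ π₀ x y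
runᴼ (bob   g π₀ π₁)      x y = if g y then runᴼ π₁ x y else runᴼ π₀ x y
runᴼ (oracle P a b π₀ π₁) x y = if P (a x) (b y) then runᴼ π₁ x y else runᴼ π₀ x y

-- Costᴼ≤ π d: on every root-to-leaf path of π, the number of communicated bits
-- plus the sum of N(P) over the oracle nodes is at most d.
data Costᴼ≤ {X Y : Set} : OracleProtocol X Y → ℕ → Set where
  leaf   : ∀ {z d} → Costᴼ≤ (leaf z) d
  alice  : ∀ {f π₀ π₁ d} → Costᴼ≤ π₀ d → Costᴼ≤ π₁ d →
           Costᴼ≤ (alice f π₀ π₁) (suc d)
  bob    : ∀ {g π₀ π₁ d} → Costᴼ≤ π₀ d → Costᴼ≤ π₁ d →
           Costᴼ≤ (bob g π₀ π₁) (suc d)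
  oracle : ∀ {p q} {P : Matrix (Fin p) (Fin q)} {a b π₀ π₁ k d} →
           N[ P ]≤ k → Costᴼ≤ π₀ d → Costᴼ≤ π₁ d →
           Costᴼ≤ (oracle P a b π₀ π₁) (k + d)

Dᴺᴾ[_]≤_ : ∀ {X Y} → Matrix X Y → ℕ → Set
Dᴺᴾ[_]≤_ {X} {Y} F d =
  ∃ λ (π : OracleProtocol X Y) → (∀ x y → runᴼ π x y ≡ F x y) × Costᴼ≤ π d

------------------------------------------------------------------------
-- Public-coin randomized protocols

-- Rational probabilities suffice.  On finite X and Y there are, up to the
-- function computed, finitely many deterministic protocols of cost at most c,
-- so the least error achievable with cost c is the value of a finite 0/1 matrix
-- game; that value is rational and attained by a rational distribution.
record RProtocol (X Y : Set) : Set where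
  field
    supportSize : ℕ
    protocol    : Fin supportSize → Protocol X Y
    weight      : Fin supportSize → ℚ
    weight>0    : ∀ i → 0ℚ ℚ.< weight i
    weight-sum  : sum +-0-commutativeMonoid weight ≡ 1ℚ

  errorProbability : Matrix X Y → X → Y → ℚ
  errorProbability F x y = sum +-0-commutativeMonoid λ i →
    if does (run (protocol i) x y Bool.≟ F x y) then 0ℚ else weight i

  Cost≤ : ℕ → Set
  Cost≤ c = ∀ i → height (protocol i) ≤ c

R⟨_⟩[_]≤_ : ∀ {X Y} → ℚ → Matrix X Y → ℕ → Set
R⟨_⟩[_]≤_ {X} {Y} ε F c = ∃ λ (π : RProtocol X Y) →
  (∀ x y → RProtocol.errorProbability π F x y ℚ.≤ ε) × RProtocol.Cost≤ π c

-- The inequality 1 ≤ (½ − ε) · 2^m says log₂ (1 / (½ − ε)) ≤ m.  Since the cost c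
-- is an integer, c + log₂ (1 / (½ − ε)) ≤ b holds iff such an integer m exists
-- with c + m ≤ b.
PP[_]≤_ : ∀ {X Y} → Matrix X Y → ℕ → Set
PP[ F ]≤ b = ∃[ ε ] ∃[ c ] ∃[ m ]
  ε ℚ.< ½ ×
  R⟨ ε ⟩[ F ]≤ c ×
  1ℚ ℚ.≤ (½ ℚ.- ε) ℚ.* (ℤ.+ (2 ^ m) ℚ./ 1) ×
  c + m ≤ b

------------------------------------------------------------------------
-- Communication complexity classes

record Problem (n : ℕ) : Set₁ where
  field
    X Y    : FiniteSet
    matrix : Matrix (Carrier X) (Carrier Y)
    n-bit  : ⌈log₂ (size X ⊔ size Y) ⌉ ≡ n

open Problem public using (matrix)

-- ⌊log₂ n⌋ is within a factor of 2 of log₂ n for n ≥ 2; the summand C covers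
-- n ≤ 1, where the logarithm vanishes.
Polylogarithmic : (ℕ → ℕ) → Set
Polylogarithmic f = ∃[ C ] ∃[ k ] ∀ n → f n ≤ C * ⌊log₂ n ⌋ ^ k + C

ClassPP : (∀ n → Problem n) → Set
ClassPP 𝓕 = ∃[ f ] Polylogarithmic f × (∀ n → PP[ matrix (𝓕 n) ]≤ f n)

ClassPᴺᴾ : (∀ n → Problem n) → Set
ClassPᴺᴾ 𝓕 = ∃[ f ] Polylogarithmic f × (∀ n → Dᴺᴾ[ matrix (𝓕 n) ]≤ f n)

{-# OPTIONS --safe #-}
-- F n is the majority of x xor y, that is, it says whether the Hamming distance of x
-- and y is at least n/2.  A random coordinate of x xor y guesses it with advantage
-- about 1/n.  A monochromatic rectangle S × T has all distances from S to T, or to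
-- the antipodes of T, at least n/2, and concentration of measure bounds its size by
-- 2^(−Ω(n)).  Conversely a matrix with Dᴺᴾ cost d has a monochromatic rectangle of
-- density 16^(−d): walking down the protocol, at a query that is a union of at most
-- 2^k rectangles, either one of them has both sides of density at least 2^(−k−1) in
-- the current rectangle, and we enter it, or deleting a small side of each leaves at
-- least half of the rows and half of the columns, on which the answer is 0.
module Submission where

open import Defs
open import Algebra.Properties.CommutativeMonoid.Sum using (sum)
open import Data.Bool using (Bool; true; false; not; _∧_; _∨_; _xor_; if_then_else_)
import Data.Bool.Properties as Bool
open import Data.Bool.Properties using (T-≡; ∨-identityʳ; ∨-assoc; ∧-zeroʳ; ∨-zeroʳ; ¬-not; ⇔→≡)
open import Data.Fin using (Fin; zero; suc; _↑ˡ_; _↑ʳ_)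
open import Data.Fin.Subset using (Subset; _∈_; _⊆_; ∣_∣; _∩_; ∁; ⊤)
open import Data.Fin.Subset.Properties using (∣⊤∣≡n; p∩q⊆p; x∈p∩q⁻; x∈∁p⇒x∉p)
import Data.Integer as ℤ
import Data.Integer.Properties as ℤ
import Data.Integer.Tactic.RingSolver as ℤ-Solver
open import Data.List using (List; []; _∷_; map; length) renaming (_++_ to _++ᴸ_)
open import Data.List.Properties using (length-map; length-++)
open import Data.Nat using (ℕ; zero; suc; _+_; _*_; _∸_; _^_; _⊔_; _≤_; _<_; _≤ᵇ_; z≤n; s≤s; s≤s⁻¹;
  ⌊_/2⌋; ⌈_/2⌉; NonZero; >-nonZero; >-nonZero⁻¹; ≢-nonZero; ≢-nonZero⁻¹)
open import Data.Nat.Induction using (<-rec)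
open import Data.Nat.Logarithm
  using (⌊log₂_⌋; ⌈log₂_⌉; ⌊log₂⌋-mono-≤; ⌊log₂⌊n/2⌋⌋≡⌊log₂n⌋∸1; ⌊log₂[2^n]⌋≡n; ⌈log₂2^n⌉≡n)
open import Data.Nat.Properties
open import Data.Nat.Tactic.RingSolver using (solve-∀)
open import Data.Product using (_×_; _,_; Σ-syntax; ∃-syntax; proj₂)
open import Data.Rational as ℚ using (ℚ; 0ℚ; 1ℚ; ½; fromℚᵘ; toℚᵘ)
import Data.Rational.Properties as ℚ
open import Data.Rational.Unnormalised as ℚᵘ using (mkℚᵘ; *≡*; *≤*; *<*)
import Data.Rational.Unnormalised.Properties as ℚᵘ
open import Data.Sum using (_⊎_; inj₁; inj₂; map₂)
open import Data.Vec using (Vec; []; _∷_; _++_; take; drop; here; there; tabulate; replicate; lookup)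
open import Data.Vec.Properties using (take++drop≡id; []=⇒lookup; lookup⇒[]=; lookup∘tabulate)
open import Function using (_⇔_; mk⇔; Equivalence; Inverse; _∘_; const; id)
open import Function.Properties.Equivalence using () renaming (trans to ⇔-trans)
open import Relation.Binary.PropositionalEquality
  using (_≡_; refl; sym; trans; cong; cong₂; subst; subst₂)
open import Relation.Nullary using (contradiction; does; yes; no)
open import Relation.Unary using (_⊈_)

-- A power law, Hamming distances and the majority matrix

^-distribʳ-* : ∀ m n o → (m * n) ^ o ≡ m ^ o * n ^ o
^-distribʳ-* m n zero    = refl
^-distribʳ-* m n (suc o) = trans (cong (m * n *_) (^-distribʳ-* m n o)) (swap m n (m ^ o) (n ^ o))
  where
  swap : ∀ a b c d → a * b * (c * d) ≡ a * c * (b * d)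
  swap = solve-∀

-- The number of coordinates at which x xor y differs from c: the Hamming distance
-- from x to y if c is false, and from x to the antipode of y if c is true.
mismatches : Bool → ∀ {n} → Vec Bool n → Vec Bool n → ℕ
mismatches c []       []       = 0
mismatches c (a ∷ x) (b ∷ y) =
  if c xor (a xor b) then suc (mismatches c x y) else mismatches c x y

majority : ∀ n → Matrix (Vec Bool n) (Vec Bool n)
majority n x y = n ≤ᵇ mismatches false x y + mismatches false x y

mismatches-sum : ∀ {n} (x y : Vec Bool n) → mismatches false x y + mismatches true x y ≡ n
mismatches-sum []          []          = refl
mismatches-sum (false ∷ x) (false ∷ y) = trans (+-suc _ _) (cong suc (mismatches-sum x y))
mismatches-sum (false ∷ x) (true ∷ y)  = cong suc (mismatches-sum x y)
mismatches-sum (true ∷ x)  (false ∷ y) = cong suc (mismatches-sum x y)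
mismatches-sum (true ∷ x)  (true ∷ y)  = trans (+-suc _ _) (cong suc (mismatches-sum x y))

majority-true : ∀ {n} (x y : Vec Bool n) → majority n x y ≡ true →
                n ≤ mismatches false x y + mismatches false x y
majority-true {n} x y eq = ≤ᵇ⇒≤ n _ (Equivalence.from T-≡ eq)

majority-false : ∀ {n} (x y : Vec Bool n) → majority n x y ≡ false →
                 mismatches false x y + mismatches false x y < n
majority-false x y eq = ≰⇒> λ n≤ →
  contradiction (trans (sym eq) (Equivalence.to T-≡ (≤⇒≤ᵇ n≤))) λ ()

double-balance : ∀ {a b n} → a + b ≡ n → a + a ≤ n → n ≤ b + b
double-balance {a} {b} refl a+a≤ = +-monoˡ-≤ b (+-cancelˡ-≤ a a b a+a≤)

-- On value 0 the distance to `y` is below n/2, so the distance to the antipode of `y` is at least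
-- n/2. One separation bound thus serves rectangles of both colours.
majority-mismatches : ∀ {n} z (x y : Vec Bool n) → majority n x y ≡ z →
                      n ≤ mismatches (not z) x y + mismatches (not z) x y
majority-mismatches true  x y eq = majority-true x y eq
majority-mismatches false x y eq = double-balance {mismatches false x y} (mismatches-sum x y) (<⇒≤ (majority-false x y eq))

-- Concentration of measure in the cube

-- The enumeration of `Bits` puts the first bit in the most significant place, so fixing it selects
-- a block of length 2^n. As `2 ^ suc n` unfolds to `2 ^ n + (2 ^ n + 0)`, the second block has an
-- empty tail to cut off.
half : Bool → ∀ {n} → Subset (2 ^ suc n) → Subset (2 ^ n)
half false {n} S = take (2 ^ n) S
half true  {n} S = take (2 ^ n) (drop (2 ^ n) S)

∣++∣ : ∀ {m n} (p : Subset m) (q : Subset n) → ∣ p ++ q ∣ ≡ ∣ p ∣ + ∣ q ∣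
∣++∣ []          q = refl
∣++∣ (false ∷ p) q = ∣++∣ p q
∣++∣ (true  ∷ p) q = cong suc (∣++∣ p q)

∣take∣+∣drop∣ : ∀ m {n} (p : Subset (m + n)) → ∣ p ∣ ≡ ∣ take m p ∣ + ∣ drop m p ∣
∣take∣+∣drop∣ m p = trans (cong ∣_∣ (sym (take++drop≡id m p))) (∣++∣ (take m p) (drop m p))

∣half∣ : ∀ n (S : Subset (2 ^ suc n)) → ∣ S ∣ ≡ ∣ half false {n} S ∣ + ∣ half true {n} S ∣
∣half∣ n S = trans (∣take∣+∣drop∣ (2 ^ n) S)
  (cong (∣ take (2 ^ n) S ∣ +_)
    (trans (∣take∣+∣drop∣ (2 ^ n) (drop (2 ^ n) S))
           (trans (cong (∣ half true {n} S ∣ +_) (∣empty∣ (drop (2 ^ n) (drop (2 ^ n) S))))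
                  (+-identityʳ _))))
  where
  ∣empty∣ : (p : Subset 0) → ∣ p ∣ ≡ 0
  ∣empty∣ [] = refl

∈-take : ∀ m {n} (p : Subset (m + n)) {i : Fin m} → i ∈ take m p → (i ↑ˡ n) ∈ p
∈-take (suc m) (_ ∷ p) here        = here
∈-take (suc m) (_ ∷ p) (there i∈p) = there (∈-take m p i∈p)

∈-drop : ∀ m {n} (p : Subset (m + n)) {i : Fin n} → i ∈ drop m p → (m ↑ʳ i) ∈ p
∈-drop zero    p       i∈p = i∈p
∈-drop (suc m) (_ ∷ p) i∈p = there (∈-drop m p i∈p)

∈-half : ∀ b {n} (S : Subset (2 ^ suc n)) (x : Vec Bool n) →
         index (Bits n) x ∈ half b {n} S → index (Bits (suc n)) (b ∷ x) ∈ S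
∈-half false {n} S x x∈ = ∈-take (2 ^ n) S x∈
∈-half true  {n} S x x∈ = ∈-drop (2 ^ n) S (∈-take (2 ^ n) (drop (2 ^ n) S) x∈)

-- 2 (p + M²/p) ≤ 5 M on M/2 ≤ p ≤ 2 M, since there (2 p − M) (p − 2 M) ≤ 0;
-- here r = p − M and s = 2 M − p.
2[p+q]≤5M-large : ∀ {p q M} .{{_ : NonZero M}} → M ≤ p → p ≤ 2 * M → p * q ≤ M * M →
                  2 * (p + q) ≤ 5 * M
2[p+q]≤5M-large {p} {q} {M} M≤p p≤2M pq≤MM =
  *-cancelˡ-≤ p {{>-nonZero (≤-trans (>-nonZero⁻¹ M) M≤p)}} (begin
    p * (2 * (p + q))                                 ≡⟨ expand p q ⟩
    2 * (p * p) + 2 * (p * q)                         ≤⟨ +-monoʳ-≤ (2 * (p * p)) (*-monoʳ-≤ 2 pq≤MM) ⟩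
    2 * (p * p) + 2 * (M * M)                         ≤⟨ m≤m+n _ (3 * (r * s) + s * s) ⟩
    2 * (p * p) + 2 * (M * M) + (3 * (r * s) + s * s) ≡⟨ identity ⟩
    p * (5 * M)                                       ∎)
  where
  open ≤-Reasoning
  r s : ℕ
  r = p ∸ M
  s = 2 * M ∸ p
  p≡M+r : p ≡ M + r
  p≡M+r = sym (m+[n∸m]≡n M≤p)
  M≡r+s : M ≡ r + s
  M≡r+s = +-cancelˡ-≡ M M (r + s) (begin-equality
    M + M       ≡⟨ cong (M +_) (sym (+-identityʳ M)) ⟩
    2 * M       ≡⟨ sym (m+[n∸m]≡n p≤2M) ⟩
    p + s       ≡⟨ cong (_+ s) p≡M+r ⟩
    M + r + s   ≡⟨ +-assoc M r s ⟩
    M + (r + s) ∎)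
  expand : ∀ p q → p * (2 * (p + q)) ≡ 2 * (p * p) + 2 * (p * q)
  expand = solve-∀
  factor : ∀ r s → 2 * ((r + s + r) * (r + s + r)) + 2 * ((r + s) * (r + s)) + (3 * (r * s) + s * s)
                   ≡ (r + s + r) * (5 * (r + s))
  factor = solve-∀
  identity : 2 * (p * p) + 2 * (M * M) + (3 * (r * s) + s * s) ≡ p * (5 * M)
  identity = subst₂ (λ p′ M′ → 2 * (p′ * p′) + 2 * (M′ * M′) + (3 * (r * s) + s * s) ≡ p′ * (5 * M′))
    (sym (trans p≡M+r (cong (_+ r) M≡r+s))) (sym M≡r+s) (factor r s)

2[p+q]≤5M : ∀ {p q M} .{{_ : NonZero M}} → p ≤ 2 * M → q ≤ 2 * M → p * q ≤ M * M →
            2 * (p + q) ≤ 5 * M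
2[p+q]≤5M {p} {q} {M} p≤2M q≤2M pq≤MM with ≤-total M p | ≤-total M q
... | inj₁ M≤p | _        = 2[p+q]≤5M-large M≤p p≤2M pq≤MM
... | inj₂ _   | inj₁ M≤q = subst (λ t → 2 * t ≤ 5 * M) (+-comm q p)
  (2[p+q]≤5M-large M≤q q≤2M (subst (_≤ M * M) (*-comm p q) pq≤MM))
... | inj₂ p≤M | inj₂ q≤M = begin
  2 * (p + q) ≤⟨ *-monoʳ-≤ 2 (+-mono-≤ p≤M q≤M) ⟩
  2 * (M + M) ≤⟨ m≤m+n _ M ⟩
  2 * (M + M) + M ≡⟨ five M ⟩
  5 * M       ∎
  where
  open ≤-Reasoning
  five : ∀ M → 2 * (M + M) + M ≡ 5 * M
  five = solve-∀

-- (a₀ b₁) (a₁ b₀) = (a₀ b₀) (a₁ b₁) makes the two larger products at most 5/2 M in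
-- total, instead of 4 M; without this gain the bound on |S| |T| would be trivial.
four-products : ∀ a₀ a₁ b₀ b₁ E {M} .{{_ : NonZero M}} →
                a₀ * b₀ * E ≤ M → a₁ * b₁ * E ≤ M →
                a₀ * b₁ * E ≤ 2 * M → a₁ * b₀ * E ≤ 2 * M →
                (a₀ + a₁) * (b₀ + b₁) * (2 * E) ≤ 9 * M
four-products a₀ a₁ b₀ b₁ E {M} u≤ v≤ p≤ q≤ = begin
  (a₀ + a₁) * (b₀ + b₁) * (2 * E)       ≡⟨ expand a₀ a₁ b₀ b₁ E ⟩
  2 * (u + v) + 2 * (p + q)             ≤⟨ +-mono-≤ (*-monoʳ-≤ 2 (+-mono-≤ u≤ v≤)) (2[p+q]≤5M p≤ q≤ pq≤MM) ⟩
  2 * (M + M) + 5 * M                   ≡⟨ nine M ⟩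
  9 * M                                 ∎
  where
  open ≤-Reasoning
  u v p q : ℕ
  u = a₀ * b₀ * E
  v = a₁ * b₁ * E
  p = a₀ * b₁ * E
  q = a₁ * b₀ * E
  swap : ∀ a₀ a₁ b₀ b₁ E → a₀ * b₁ * E * (a₁ * b₀ * E) ≡ a₀ * b₀ * E * (a₁ * b₁ * E)
  swap = solve-∀
  pq≤MM : p * q ≤ M * M
  pq≤MM = subst (_≤ M * M) (sym (swap a₀ a₁ b₀ b₁ E)) (*-mono-≤ u≤ v≤)
  expand : ∀ a₀ a₁ b₀ b₁ E → (a₀ + a₁) * (b₀ + b₁) * (2 * E) ≡
           2 * (a₀ * b₀ * E + a₁ * b₁ * E) + 2 * (a₀ * b₁ * E + a₁ * b₀ * E)
  expand = solve-∀
  nine : ∀ M → 2 * (M + M) + 5 * M ≡ 9 * M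
  nine = solve-∀

-- Lowering the distance by one costs a factor 2 in the weight 2^d. At d = 0 the truncated
-- subtraction lowers nothing and the factor is slack.
weaken-distance : ∀ a d e {M} → a * (2 ^ (d ∸ 1) * e) ≤ M → a * (2 ^ d * e) ≤ 2 * M
weaken-distance a zero    e {M} h = ≤-trans h (m≤m+n M _)
weaken-distance a (suc d) e {M} h = subst (_≤ 2 * M) (swap a (2 ^ d) e) (*-monoʳ-≤ 2 h)
  where
  swap : ∀ a b e → 2 * (a * (b * e)) ≡ a * (2 * b * e)
  swap = solve-∀

-- Induction on the first coordinate. Pairs of halves whose first bits add no mismatch keep distance
-- d, the other pairs keep at least d - 1, and `four-products` adds up the four bounds. Relative to
-- 4^n the bound is (9/8)^n · 2^(-d), which decays exponentially at d = n/2.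
separated : ∀ n c d S T →
            (∀ x y → index (Bits n) x ∈ S → index (Bits n) y ∈ T → d ≤ mismatches c x y) →
            ∣ S ∣ * ∣ T ∣ * (2 ^ d * 2 ^ n) ≤ 9 ^ n
separated zero c d (false ∷ []) T            sep = z≤n
separated zero c d (true ∷ [])  (false ∷ []) sep = z≤n
-- Both sets contain the empty word, at distance 0 from itself, which forces d = 0.
separated zero c d (true ∷ [])  (true ∷ [])  sep with z≤n ← sep [] [] here here = s≤s z≤n
separated (suc n) c d S T sep = begin
  ∣ S ∣ * ∣ T ∣ * (2 ^ d * (2 * 2 ^ n))
    ≡⟨ cong₂ (λ s t → s * t * (2 ^ d * (2 * 2 ^ n))) (∣half∣ n S) (∣half∣ n T) ⟩
  (s false + s true) * (t false + t true) * (2 ^ d * (2 * 2 ^ n))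
    ≡⟨ cong ((s false + s true) * (t false + t true) *_) (swap (2 ^ d) (2 ^ n)) ⟩
  (s false + s true) * (t false + t true) * (2 * (2 ^ d * 2 ^ n))
    ≤⟨ combine c refl ⟩
  9 * 9 ^ n ∎
  where
  open ≤-Reasoning
  instance
    9^n≢0 : NonZero (9 ^ n)
    9^n≢0 = m^n≢0 9 n
  s t : Bool → ℕ
  s b = ∣ half b {n} S ∣
  t b = ∣ half b {n} T ∣
  swap : ∀ a b → a * (2 * b) ≡ 2 * (a * b)
  swap = solve-∀

  halves : ∀ a b {e} → (∀ x y → d ≤ mismatches c (a ∷ x) (b ∷ y) → e ≤ mismatches c x y) →
           s a * t b * (2 ^ e * 2 ^ n) ≤ 9 ^ n
  halves a b {e} e≤ = separated n c e (half a {n} S) (half b {n} T) λ x y x∈ y∈ →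
    e≤ x y (sep (a ∷ x) (b ∷ y) (∈-half a {n} S x x∈) (∈-half b {n} T y y∈))

  match : ∀ a b → c xor (a xor b) ≡ false → s a * t b * (2 ^ d * 2 ^ n) ≤ 9 ^ n
  match a b eq = halves a b λ x y d≤ →
    subst (λ z → d ≤ (if z then suc (mismatches c x y) else mismatches c x y)) eq d≤

  mismatch : ∀ a b → s a * t b * (2 ^ d * 2 ^ n) ≤ 2 * 9 ^ n
  mismatch a b = weaken-distance (s a * t b) d (2 ^ n) (halves a b pred≤)
    where
    pred≤ : ∀ x y → d ≤ mismatches c (a ∷ x) (b ∷ y) → d ∸ 1 ≤ mismatches c x y
    pred≤ x y d≤ with c xor (a xor b)
    ... | true  = ∸-monoˡ-≤ 1 d≤
    ... | false = ≤-trans (m∸n≤m d 1) d≤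

  combine : ∀ c′ → c ≡ c′ → (s false + s true) * (t false + t true) * (2 * (2 ^ d * 2 ^ n)) ≤ 9 * 9 ^ n
  combine false refl = four-products (s false) (s true) (t false) (t true) (2 ^ d * 2 ^ n)
    (match false false refl) (match true true refl) (mismatch false true) (mismatch true false)
  -- Passing to antipodes flips the first bit of `y`, so the two halves of `T` change places.
  combine true refl =
    subst (λ t′ → (s false + s true) * t′ * (2 * (2 ^ d * 2 ^ n)) ≤ 9 * 9 ^ n) (+-comm (t true) (t false))
      (four-products (s false) (s true) (t true) (t false) (2 ^ d * 2 ^ n)
        (match false true refl) (match true false refl) (mismatch false false) (mismatch true true))

-- Monochromatic rectangles of majority

-- At d = ⌈n/2⌉ the density is at most (9/(8√2))^n, and 4 is the least power taking this base below
-- 1/2. Cleared of denominators, this reads 2 · 9⁴ = 13122 ≤ 16384 = 64 · 256, where 64^n = 4^n ·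
-- 16^n bounds the fourth power of 2^d · 2^n from below.
majority-rect : ∀ n → 2^[ n / 4 ]≤rect⁻¹ {Bits n} {Bits n} (majority n)
majority-rect n S T (z , mono) = *-cancelˡ-≤ (64 ^ n) {{m^n≢0 64 n}} (begin
  64 ^ n * (2 ^ n * v ^ 4)                ≡⟨ cong (λ w → w * (2 ^ n * v ^ 4)) (^-distribʳ-* 4 16 n) ⟩
  4 ^ n * 16 ^ n * (2 ^ n * v ^ 4)        ≡⟨ swap (4 ^ n) (16 ^ n) (2 ^ n) (v ^ 4) ⟩
  2 ^ n * (v ^ 4 * (4 ^ n * 16 ^ n))
    ≤⟨ *-monoʳ-≤ (2 ^ n) (*-monoʳ-≤ (v ^ 4) (*-mono-≤ 4^n≤2^d^4 (≤-reflexive (^-swap 2 4 n)))) ⟩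
  2 ^ n * (v ^ 4 * ((2 ^ d) ^ 4 * (2 ^ n) ^ 4))
    ≡⟨ cong (2 ^ n *_) (trans (cong (v ^ 4 *_) (sym (^-distribʳ-* (2 ^ d) (2 ^ n) 4)))
                              (sym (^-distribʳ-* v (2 ^ d * 2 ^ n) 4))) ⟩
  2 ^ n * (v * (2 ^ d * 2 ^ n)) ^ 4       ≤⟨ *-monoʳ-≤ (2 ^ n) (^-monoˡ-≤ 4 concentrated) ⟩
  2 ^ n * (9 ^ n) ^ 4                     ≡⟨ cong (2 ^ n *_) (sym (^-swap 9 4 n)) ⟩
  2 ^ n * 6561 ^ n                        ≡⟨ sym (^-distribʳ-* 2 6561 n) ⟩
  13122 ^ n                               ≤⟨ ^-monoˡ-≤ n (≤ᵇ⇒≤ 13122 16384 _) ⟩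
  16384 ^ n                               ≡⟨ ^-distribʳ-* 64 256 n ⟩
  64 ^ n * 256 ^ n                        ≡⟨ cong (64 ^ n *_) (trans (^-swap 4 4 n) (cong (_^ 4) (^-distribʳ-* 2 2 n))) ⟩
  64 ^ n * (2 ^ n * 2 ^ n) ^ 4            ∎)
  where
  open ≤-Reasoning
  v d : ℕ
  v = ∣ S ∣ * ∣ T ∣
  d = ⌈ n /2⌉

  swap : ∀ a b c e → a * b * (c * e) ≡ c * (e * (a * b))
  swap = solve-∀

  ^-swap : ∀ b k m → (b ^ k) ^ m ≡ (b ^ m) ^ k
  ^-swap b k m = trans (^-*-assoc b k m) (trans (cong (b ^_) (*-comm k m)) (sym (^-*-assoc b m k)))

  n≤2d : n ≤ d + d
  n≤2d = subst (_≤ d + d) (⌊n/2⌋+⌈n/2⌉≡n n) (+-monoˡ-≤ d (⌊n/2⌋≤⌈n/2⌉ n))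

  4^n≤2^d^4 : 4 ^ n ≤ (2 ^ d) ^ 4
  4^n≤2^d^4 = begin
    4 ^ n             ≤⟨ ^-monoʳ-≤ 4 n≤2d ⟩
    4 ^ (d + d)       ≡⟨ ^-distribˡ-+-* 4 d d ⟩
    4 ^ d * 4 ^ d     ≡⟨ sym (^-distribʳ-* 4 4 d) ⟩
    16 ^ d            ≡⟨ ^-swap 2 4 d ⟩
    (2 ^ d) ^ 4       ∎

  concentrated : v * (2 ^ d * 2 ^ n) ≤ 9 ^ n
  concentrated = separated n (not z) d S T λ x y x∈ y∈ →
    subst (d ≤_) (sym (n≡⌈n+n/2⌉ _)) (⌈n/2⌉-mono (majority-mismatches z x y (mono x y x∈ y∈)))

-- The randomized protocol

sumℕ : ∀ {m} → (Fin m → ℕ) → ℕ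
sumℕ = sum +-0-commutativeMonoid

sumℚ : ∀ {m} → (Fin m → ℚ) → ℚ
sumℚ = sum ℚ.+-0-commutativeMonoid

-- All probabilities of the protocol share one denominator, `suc d-1`, so their sums and comparisons
-- reduce to those of natural numerators.
module Fractions (d-1 : ℕ) where

  frac : ℕ → ℚ
  frac w = fromℚᵘ (mkℚᵘ (ℤ.+ w) d-1)

  toℚᵘ-frac : ∀ w → toℚᵘ (frac w) ℚᵘ.≃ mkℚᵘ (ℤ.+ w) d-1
  toℚᵘ-frac w = ℚ.toℚᵘ-fromℚᵘ (mkℚᵘ (ℤ.+ w) d-1)

  frac-+ : ∀ v w → frac v ℚ.+ frac w ≡ frac (v + w)
  frac-+ v w = ℚ.toℚᵘ-injective (begin-equality
    toℚᵘ (frac v ℚ.+ frac w)                       ≃⟨ ℚ.toℚᵘ-homo-+ (frac v) (frac w) ⟩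
    toℚᵘ (frac v) ℚᵘ.+ toℚᵘ (frac w)               ≃⟨ ℚᵘ.+-cong (toℚᵘ-frac v) (toℚᵘ-frac w) ⟩
    mkℚᵘ (ℤ.+ v) d-1 ℚᵘ.+ mkℚᵘ (ℤ.+ w) d-1         ≃⟨ *≡* (common (ℤ.+ v) (ℤ.+ w) (ℤ.+ suc d-1)) ⟩
    mkℚᵘ (ℤ.+ (v + w)) d-1                         ≃⟨ toℚᵘ-frac (v + w) ⟨
    toℚᵘ (frac (v + w))                            ∎)
    where
    open ℚᵘ.≤-Reasoning
    common : ∀ a b c → (a ℤ.* c ℤ.+ b ℤ.* c) ℤ.* c ≡ (a ℤ.+ b) ℤ.* (c ℤ.* c)
    common = ℤ-Solver.solve-∀

  frac-0 : frac 0 ≡ 0ℚ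
  frac-0 = ℚ.fromℚᵘ-cong {mkℚᵘ (ℤ.+ 0) d-1} {ℚᵘ.0ℚᵘ} (*≡* refl)

  frac-≤ : ∀ {v w} → v ≤ w → frac v ℚ.≤ frac w
  frac-≤ {v} {w} v≤w = ℚ.toℚᵘ-cancel-≤ (begin
    toℚᵘ (frac v)     ≃⟨ toℚᵘ-frac v ⟩
    mkℚᵘ (ℤ.+ v) d-1  ≤⟨ *≤* (ℤ.*-monoʳ-≤-nonNeg (ℤ.+ suc d-1) (ℤ.+≤+ v≤w)) ⟩
    mkℚᵘ (ℤ.+ w) d-1  ≃⟨ toℚᵘ-frac w ⟨
    toℚᵘ (frac w)     ∎)
    where open ℚᵘ.≤-Reasoning

  frac>0 : ∀ w → 0ℚ ℚ.< frac (suc w)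
  frac>0 w = ℚ.toℚᵘ-cancel-< (ℚᵘ.<-respʳ-≃ (ℚᵘ.≃-sym (toℚᵘ-frac (suc w)))
    (ℚᵘ.positive⁻¹ _))

  frac-sum : ∀ {m} (p : Fin m → ℚ) (w : Fin m → ℕ) → (∀ i → p i ≡ frac (w i)) →
             sumℚ p ≡ frac (sumℕ w)
  frac-sum {zero}  p w p≡w = sym frac-0
  frac-sum {suc m} p w p≡w = trans
    (cong₂ ℚ._+_ (p≡w zero) (frac-sum (p ∘ suc) (w ∘ suc) (p≡w ∘ suc)))
    (frac-+ (w zero) (sumℕ (w ∘ suc)))

  frac-1 : frac (suc d-1) ≡ 1ℚ
  frac-1 = ℚ.fromℚᵘ-cong {mkℚᵘ (ℤ.+ suc d-1) d-1} {ℚᵘ.1ℚᵘ} (*≡* (ℤ.*-comm (ℤ.+ suc d-1) (ℤ.+ 1)))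

compare : ∀ {n} → Fin n → Protocol (Vec Bool n) (Vec Bool n)
compare i = alice (λ x → lookup x i)
  (bob (λ y → lookup y i) (leaf false) (leaf true))
  (bob (λ y → lookup y i) (leaf true) (leaf false))

-- A uniformly random coordinate has weight 2/(2n+1); the constant protocol,
-- of weight 1/(2n+1), breaks the tie.
module _ (n : ℕ) where

  open Fractions (n + n)

  sampleᴾ : Fin (suc n) → Protocol (Vec Bool n) (Vec Bool n)
  sampleᴾ zero    = leaf true
  sampleᴾ (suc i) = compare i

  sampleʷ : Fin (suc n) → ℕ
  sampleʷ zero    = 1
  sampleʷ (suc i) = 2

  sum-sampleʷ : sumℕ sampleʷ ≡ suc (n + n)
  sum-sampleʷ = cong suc (twos n)
    where
    twos : ∀ m → sumℕ {m} (λ _ → 2) ≡ m + m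
    twos zero    = refl
    twos (suc m) = cong suc (trans (cong suc (twos m)) (sym (+-suc m m)))

  sample : RProtocol (Vec Bool n) (Vec Bool n)
  sample = record
    { supportSize = suc n
    ; protocol    = sampleᴾ
    ; weight      = frac ∘ sampleʷ
    ; weight>0    = λ { zero → frac>0 0 ; (suc i) → frac>0 1 }
    ; weight-sum  = trans (frac-sum _ sampleʷ (λ _ → refl)) (trans (cong frac sum-sampleʷ) frac-1)
    }

  sample-height : RProtocol.Cost≤ sample 2
  sample-height zero    = z≤n
  sample-height (suc i) = ≤-refl

errors : Bool → Bool → ℕ → ℕ
errors z′ z w = if does (z′ Bool.≟ z) then 0 else w

-- Sampling coordinate i errs exactly when the i-th bit of x xor y differs from `z`, and each such
-- coordinate contributes numerator 2.
compare-errors : ∀ z {n} (x y : Vec Bool n) →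
  sumℕ (λ i → errors (run (compare i) x y) z 2) ≡ mismatches z x y + mismatches z x y
compare-errors z []      []      = refl
compare-errors z (a ∷ x) (b ∷ y) =
  trans (cong (errors (run (compare zero) (a ∷ x) (b ∷ y)) z 2 +_) (compare-errors z x y)) (step z a b)
  where
  step : ∀ z a b → errors (run (compare zero) (a ∷ x) (b ∷ y)) z 2 + (mismatches z x y + mismatches z x y) ≡
         mismatches z (a ∷ x) (b ∷ y) + mismatches z (a ∷ x) (b ∷ y)
  step false false false = refl
  step false false true  = cong suc (sym (+-suc _ _))
  step false true  false = cong suc (sym (+-suc _ _))
  step false true  true  = refl
  step true  false false = cong suc (sym (+-suc _ _))
  step true  false true  = refl
  step true  true  false = refl
  step true  true  true  = cong suc (sym (+-suc _ _))

-- On value 0 the constant protocol errs, but its numerator 1 fits because twice the distance is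
-- strictly below n. On value 1 it is correct, which is what settles a tie.
majority-errors : ∀ {n} z (x y : Vec Bool n) → majority n x y ≡ z →
                  errors true z 1 + (mismatches z x y + mismatches z x y) ≤ n
majority-errors false x y eq = majority-false x y eq
majority-errors {n} true x y eq = +-cancelʳ-≤ n _ _ (begin
  t + t + n       ≤⟨ +-monoʳ-≤ (t + t) (majority-true x y eq) ⟩
  t + t + (f + f) ≡⟨ swap t f ⟩
  (f + t) + (f + t) ≡⟨ cong₂ _+_ (mismatches-sum x y) (mismatches-sum x y) ⟩
  n + n           ∎)
  where
  open ≤-Reasoning
  t f : ℕ
  t = mismatches true x y
  f = mismatches false x y
  swap : ∀ t f → t + t + (f + f) ≡ (f + t) + (f + t)
  swap = solve-∀

sample-error : ∀ n x y → RProtocol.errorProbability (sample n) (majority n) x y ℚ.≤ Fractions.frac (n + n) n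
sample-error n x y = subst (ℚ._≤ frac n) (sym (frac-sum _ err frac-err)) (frac-≤ err≤)
  where
  open Fractions (n + n)
  err : Fin (suc n) → ℕ
  err i = errors (run (sampleᴾ n i) x y) (majority n x y) (sampleʷ n i)
  frac-err : ∀ i → (if does (run (sampleᴾ n i) x y Bool.≟ majority n x y) then 0ℚ else frac (sampleʷ n i))
                   ≡ frac (err i)
  frac-err i with does (run (sampleᴾ n i) x y Bool.≟ majority n x y)
  ... | true  = sym frac-0
  ... | false = refl
  err≤ : sumℕ err ≤ n
  err≤ = subst (_≤ n) (sym (cong (err zero +_) (compare-errors (majority n x y) x y)))
    (majority-errors (majority n x y) x y refl)

n<2^[1+⌊log₂n⌋] : ∀ n → n < 2 ^ suc ⌊log₂ n ⌋
n<2^[1+⌊log₂n⌋] = <-rec _ step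
  where
  open ≤-Reasoning
  step : ∀ n → (∀ {m} → m < n → m < 2 ^ suc ⌊log₂ m ⌋) → n < 2 ^ suc ⌊log₂ n ⌋
  step 0 ih = s≤s z≤n
  step 1 ih = s≤s (s≤s z≤n)
  step n@(suc (suc m)) ih = begin-strict
    n                          ≡⟨ sym (⌊n/2⌋+⌈n/2⌉≡n n) ⟩
    ⌊ n /2⌋ + ⌈ n /2⌉          ≤⟨ +-monoʳ-≤ ⌊ n /2⌋ (⌊n/2⌋-mono (n≤1+n (suc n))) ⟩
    ⌊ n /2⌋ + suc ⌊ n /2⌋      <⟨ +-mono-<-≤ half< half< ⟩
    2 ^ suc l + 2 ^ suc l      ≡⟨ cong (2 ^ suc l +_) (sym (+-identityʳ _)) ⟩
    2 ^ suc (suc l)            ≡⟨ cong (λ l → 2 ^ suc (suc l)) (⌊log₂⌊n/2⌋⌋≡⌊log₂n⌋∸1 n) ⟩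
    2 ^ suc (suc (⌊log₂ n ⌋ ∸ 1)) ≡⟨ cong (λ l → 2 ^ suc l) log>0 ⟩
    2 ^ suc ⌊log₂ n ⌋          ∎
    where
    l = ⌊log₂ ⌊ n /2⌋ ⌋
    half< : ⌊ n /2⌋ < 2 ^ suc l
    half< = ih (⌊n/2⌋<n (suc m))
    log>0 : suc (⌊log₂ n ⌋ ∸ 1) ≡ ⌊log₂ n ⌋
    log>0 = m+[n∸m]≡n (⌊log₂⌋-mono-≤ {2} {n} (s≤s (s≤s z≤n)))

module _ (n : ℕ) where

  open Fractions (n + n)

  -- The gap ½ - n/(2n+1) equals 1/(2(2n+1)).
  advantage : ∀ m → 2 * suc (n + n) ≤ 2 ^ m →
              1ℚ ℚ.≤ (½ ℚ.- frac n) ℚ.* (ℤ.+ (2 ^ m) ℚ./ 1)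
  advantage m le = ℚ.toℚᵘ-cancel-≤ (begin
    ℚᵘ.1ℚᵘ  ≤⟨ *≤* (ℤ.≤-trans (ℤ.≤-reflexive (left (ℤ.+ suc (n + n))))
                    (ℤ.≤-trans (ℤ.+≤+ le) (ℤ.≤-reflexive (right (ℤ.+ n) (ℤ.+ (2 ^ m)))))) ⟩
    (ℚᵘ.½ ℚᵘ.- mkℚᵘ (ℤ.+ n) (n + n)) ℚᵘ.* mkℚᵘ (ℤ.+ (2 ^ m)) 0
      ≃⟨ ℚᵘ.*-cong (ℚᵘ.+-congʳ ℚᵘ.½ (ℚᵘ.-‿cong (toℚᵘ-frac n))) (ℚ.toℚᵘ-fromℚᵘ (mkℚᵘ (ℤ.+ (2 ^ m)) 0)) ⟨
    (ℚᵘ.½ ℚᵘ.- toℚᵘ ε) ℚᵘ.* toℚᵘ (ℤ.+ (2 ^ m) ℚ./ 1)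
      ≃⟨ ℚᵘ.*-congʳ (ℚᵘ.≃-trans (ℚ.toℚᵘ-homo-+ ½ (ℚ.- ε)) (ℚᵘ.+-congʳ ℚᵘ.½ (ℚ.toℚᵘ-homo‿- ε))) ⟨
    toℚᵘ (½ ℚ.- ε) ℚᵘ.* toℚᵘ (ℤ.+ (2 ^ m) ℚ./ 1)  ≃⟨ ℚ.toℚᵘ-homo-* (½ ℚ.- ε) _ ⟨
    toℚᵘ ((½ ℚ.- ε) ℚ.* (ℤ.+ (2 ^ m) ℚ./ 1))  ∎)
    where
    open ℚᵘ.≤-Reasoning
    ε = frac n
    left : ∀ s → ℤ.+ 1 ℤ.* (ℤ.+ 2 ℤ.* s ℤ.* ℤ.+ 1) ≡ ℤ.+ 2 ℤ.* s
    left = ℤ-Solver.solve-∀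
    right : ∀ a p → p ≡ ((ℤ.+ 1 ℤ.* (ℤ.+ 1 ℤ.+ (a ℤ.+ a)) ℤ.+ ℤ.- a ℤ.* ℤ.+ 2) ℤ.* p) ℤ.* ℤ.+ 1
    right = ℤ-Solver.solve-∀

  frac<½ : frac n ℚ.< ½
  frac<½ = ℚ.toℚᵘ-cancel-< (ℚᵘ.<-respˡ-≃ (ℚᵘ.≃-sym (toℚᵘ-frac n)) (*<* (begin-strict
    ℤ.+ n ℤ.* ℤ.+ 2           ≡⟨ twice (ℤ.+ n) ⟩
    ℤ.+ (n + n)               <⟨ ℤ.+<+ (n<1+n (n + n)) ⟩
    ℤ.+ suc (n + n)           ≡⟨ ℤ.*-identityˡ _ ⟨
    ℤ.+ 1 ℤ.* ℤ.+ suc (n + n) ∎)))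
    where
    open ℤ.≤-Reasoning
    twice : ∀ a → a ℤ.* ℤ.+ 2 ≡ a ℤ.+ a
    twice = ℤ-Solver.solve-∀

majority-PP : ∀ n → PP[ majority n ]≤ (6 + ⌊log₂ n ⌋)
-- Two bits are communicated; the inverse gap 2(2n+1) is below 4(n+1), which is at most 2^(3 + ⌊log₂
-- n⌋), so m = 4 + ⌊log₂ n⌋ suffices.
majority-PP n = Fractions.frac (n + n) n , 2 , 4 + ⌊log₂ n ⌋ , frac<½ n ,
  (sample n , sample-error n , sample-height n) , advantage n (4 + ⌊log₂ n ⌋) bound , ≤-refl
  where
  open ≤-Reasoning
  p : ℕ
  p = 2 ^ suc ⌊log₂ n ⌋
  bound : 2 * suc (n + n) ≤ 2 ^ (4 + ⌊log₂ n ⌋)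
  bound = begin
    2 * suc (n + n)     ≤⟨ m≤m+n _ 2 ⟩
    2 * suc (n + n) + 2 ≡⟨ expand n ⟩
    4 * suc n           ≤⟨ *-monoʳ-≤ 4 (n<2^[1+⌊log₂n⌋] n) ⟩
    4 * p               ≤⟨ *-monoˡ-≤ p (≤ᵇ⇒≤ 4 8 _) ⟩
    8 * p               ≡⟨ eight p ⟩
    2 ^ (4 + ⌊log₂ n ⌋) ∎
    where
    expand : ∀ n → 2 * suc (n + n) + 2 ≡ 4 * suc n
    expand = solve-∀
    eight : ∀ p → 8 * p ≡ 2 * (2 * (2 * p))
    eight = solve-∀

-- Rectangles in protocols with a nondeterministic oracle

-- Sides are predicates, so that a rectangle of a query matrix pulls back along the query maps by
-- composition.
Rectangle : Set → Set → Set
Rectangle X Y = (X → Bool) × (Y → Bool)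

covers : ∀ {X Y} → List (Rectangle X Y) → Matrix X Y
covers []            x y = false
covers ((A , B) ∷ ℛ) x y = A x ∧ B y ∨ covers ℛ x y

covers-++ : ∀ {X Y} (ℛ 𝒮 : List (Rectangle X Y)) x y →
            covers (ℛ ++ᴸ 𝒮) x y ≡ covers ℛ x y ∨ covers 𝒮 x y
covers-++ []            𝒮 x y = refl
covers-++ ((A , B) ∷ ℛ) 𝒮 x y =
  trans (cong (A x ∧ B y ∨_) (covers-++ ℛ 𝒮 x y)) (sym (∨-assoc (A x ∧ B y) _ _))

_⊓ᴬ_ : ∀ {X Y} → (X → Bool) → List (Rectangle X Y) → List (Rectangle X Y)
f ⊓ᴬ ℛ = map (λ (A , B) → (λ x → f x ∧ A x) , B) ℛ

_⊓ᴮ_ : ∀ {X Y} → (Y → Bool) → List (Rectangle X Y) → List (Rectangle X Y)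
g ⊓ᴮ ℛ = map (λ (A , B) → A , (λ y → g y ∧ B y)) ℛ

covers-⊓ᴬ : ∀ {X Y} f (ℛ : List (Rectangle X Y)) x y → covers (f ⊓ᴬ ℛ) x y ≡ f x ∧ covers ℛ x y
covers-⊓ᴬ f [] x y = sym (∧-zeroʳ (f x))
covers-⊓ᴬ f ((A , B) ∷ ℛ) x y with f x in eq | covers-⊓ᴬ f ℛ x y
... | true  | ih = cong (A x ∧ B y ∨_) ih
... | false | ih = ih

covers-⊓ᴮ : ∀ {X Y} g (ℛ : List (Rectangle X Y)) x y → covers (g ⊓ᴮ ℛ) x y ≡ g y ∧ covers ℛ x y
covers-⊓ᴮ g [] x y = sym (∧-zeroʳ (g y))
covers-⊓ᴮ g ((A , B) ∷ ℛ) x y with g y in eq | covers-⊓ᴮ g ℛ x y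
... | true  | ih = cong (A x ∧ B y ∨_) ih
... | false | ih = trans (cong (_∨ _) (∧-zeroʳ (A x))) ih

-- One rectangle for each leaf labelled 1: the inputs that reach it.
accepting : ∀ {X Y} → Protocol X Y → List (Rectangle X Y)
accepting (leaf false)    = []
accepting (leaf true)     = (const true , const true) ∷ []
accepting (alice f π₀ π₁) = ((not ∘ f) ⊓ᴬ accepting π₀) ++ᴸ (f ⊓ᴬ accepting π₁)
accepting (bob g π₀ π₁)   = ((not ∘ g) ⊓ᴮ accepting π₀) ++ᴸ (g ⊓ᴮ accepting π₁)

if-∨ : ∀ b {p q r s} → p ≡ not b ∧ r → q ≡ b ∧ s → p ∨ q ≡ (if b then s else r)
if-∨ true          refl refl = refl
if-∨ false {r = r} refl refl = ∨-identityʳ r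

covers-accepting : ∀ {X Y} (π : Protocol X Y) x y → covers (accepting π) x y ≡ run π x y
covers-accepting (leaf false) x y = refl
covers-accepting (leaf true)  x y = refl
covers-accepting (alice f π₀ π₁) x y = trans (covers-++ ((not ∘ f) ⊓ᴬ accepting π₀) (f ⊓ᴬ accepting π₁) x y)
  (if-∨ (f x) (trans (covers-⊓ᴬ (not ∘ f) (accepting π₀) x y) (cong (not (f x) ∧_) (covers-accepting π₀ x y)))
              (trans (covers-⊓ᴬ f (accepting π₁) x y) (cong (f x ∧_) (covers-accepting π₁ x y))))
covers-accepting (bob g π₀ π₁) x y = trans (covers-++ ((not ∘ g) ⊓ᴮ accepting π₀) (g ⊓ᴮ accepting π₁) x y)
  (if-∨ (g y) (trans (covers-⊓ᴮ (not ∘ g) (accepting π₀) x y) (cong (not (g y) ∧_) (covers-accepting π₀ x y)))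
              (trans (covers-⊓ᴮ g (accepting π₁) x y) (cong (g y ∧_) (covers-accepting π₁ x y))))

length-accepting : ∀ {X Y} (π : Protocol X Y) → length (accepting π) ≤ 2 ^ height π
length-node : ∀ {X Y} (π₀ π₁ : Protocol X Y) φ ψ →
              length (map φ (accepting π₀) ++ᴸ map ψ (accepting π₁)) ≤ 2 ^ suc (height π₀ ⊔ height π₁)

length-accepting (leaf false)    = z≤n
length-accepting (leaf true)     = s≤s z≤n
length-accepting (alice f π₀ π₁) = length-node π₀ π₁ _ _
length-accepting (bob g π₀ π₁)   = length-node π₀ π₁ _ _

length-node π₀ π₁ φ ψ = begin
  length (map φ (accepting π₀) ++ᴸ map ψ (accepting π₁))    ≡⟨ length-++ (map φ (accepting π₀)) ⟩
  length (map φ (accepting π₀)) + length (map ψ (accepting π₁))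
    ≡⟨ cong₂ _+_ (length-map φ (accepting π₀)) (length-map ψ (accepting π₁)) ⟩
  length (accepting π₀) + length (accepting π₁)           ≤⟨ +-mono-≤ (length-accepting π₀) (length-accepting π₁) ⟩
  2 ^ height π₀ + 2 ^ height π₁
    ≤⟨ +-mono-≤ (^-monoʳ-≤ 2 (m≤m⊔n (height π₀) (height π₁))) (^-monoʳ-≤ 2 (m≤n⊔m (height π₀) (height π₁))) ⟩
  2 ^ h + 2 ^ h                                           ≡⟨ cong (2 ^ h +_) (sym (+-identityʳ _)) ⟩
  2 ^ suc h                                               ∎
  where
  open ≤-Reasoning
  h = height π₀ ⊔ height π₁

acceptingᴺ : ∀ {X Y} k → (Vec Bool k → Protocol X Y) → List (Rectangle X Y)
acceptingᴺ zero    π = accepting (π [])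
acceptingᴺ (suc k) π = acceptingᴺ k (π ∘ (false ∷_)) ++ᴸ acceptingᴺ k (π ∘ (true ∷_))

covers-acceptingᴺ : ∀ {X Y} k (π : Vec Bool k → Protocol X Y) x y →
                    (∃[ a ] run (π a) x y ≡ true) ⇔ covers (acceptingᴺ k π) x y ≡ true
covers-acceptingᴺ zero π x y = mk⇔
  (λ { ([] , eq) → trans (covers-accepting (π []) x y) eq })
  (λ eq → [] , trans (sym (covers-accepting (π []) x y)) eq)
covers-acceptingᴺ (suc k) π x y = mk⇔ to from
  where
  ih : ∀ b → (∃[ a ] run (π (b ∷ a)) x y ≡ true) ⇔ covers (acceptingᴺ k (π ∘ (b ∷_))) x y ≡ true
  ih b = covers-acceptingᴺ k (π ∘ (b ∷_)) x y
  split = covers-++ (acceptingᴺ k (π ∘ (false ∷_))) (acceptingᴺ k (π ∘ (true ∷_))) x y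

  ∨-true : ∀ p q → p ∨ q ≡ true → p ≡ true ⊎ q ≡ true
  ∨-true true  q eq = inj₁ refl
  ∨-true false q eq = inj₂ eq

  ∨-trueˡ : ∀ {p} q → p ≡ true → p ∨ q ≡ true
  ∨-trueˡ q refl = refl

  ∨-trueʳ : ∀ p {q} → q ≡ true → p ∨ q ≡ true
  ∨-trueʳ p refl = ∨-zeroʳ p

  to : (∃[ a ] run (π a) x y ≡ true) → covers (acceptingᴺ (suc k) π) x y ≡ true
  to (false ∷ a , eq) = trans split (∨-trueˡ _ (Equivalence.to (ih false) (a , eq)))
  to (true ∷ a , eq)  = trans split (∨-trueʳ _ (Equivalence.to (ih true) (a , eq)))

  from : covers (acceptingᴺ (suc k) π) x y ≡ true → ∃[ a ] run (π a) x y ≡ true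
  from eq with ∨-true _ _ (trans (sym split) eq)
  ... | inj₁ eq₀ = let a , r = Equivalence.from (ih false) eq₀ in false ∷ a , r
  ... | inj₂ eq₁ = let a , r = Equivalence.from (ih true) eq₁ in true ∷ a , r

length-acceptingᴺ : ∀ {X Y} k (π : Vec Bool k → Protocol X Y) c →
                    (∀ a → k + height (π a) ≤ c) → length (acceptingᴺ k π) ≤ 2 ^ c
length-acceptingᴺ zero π c cost = ≤-trans (length-accepting (π [])) (^-monoʳ-≤ 2 (cost []))
length-acceptingᴺ (suc k) π zero    cost = contradiction (cost (replicate _ false)) λ ()
length-acceptingᴺ (suc k) π (suc c) cost = begin
  length (acceptingᴺ k (π ∘ (false ∷_)) ++ᴸ acceptingᴺ k (π ∘ (true ∷_)))
    ≡⟨ length-++ (acceptingᴺ k (π ∘ (false ∷_))) ⟩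
  length (acceptingᴺ k (π ∘ (false ∷_))) + length (acceptingᴺ k (π ∘ (true ∷_)))
    ≤⟨ +-mono-≤ (length-acceptingᴺ k _ c λ a → s≤s⁻¹ (cost (false ∷ a)))
                (length-acceptingᴺ k _ c λ a → s≤s⁻¹ (cost (true ∷ a))) ⟩
  2 ^ c + 2 ^ c  ≡⟨ cong (2 ^ c +_) (sym (+-identityʳ _)) ⟩
  2 ^ suc c      ∎
  where open ≤-Reasoning

-- An advice string together with a 1-leaf of its protocol determines a rectangle, and advice length
-- plus height is at most k.
rectangle-cover : ∀ {X Y} {P : Matrix X Y} {k} → N[ P ]≤ k →
                  ∃[ ℛ ] length ℛ ≤ 2 ^ k × (∀ x y → P x y ≡ covers ℛ x y)
rectangle-cover (π , computes , cost) =
  acceptingᴺ adviceLength protocol ,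
  length-acceptingᴺ adviceLength protocol _ cost ,
  λ x y → ⇔→≡ {z = true}
    (⇔-trans (computes x y) (covers-acceptingᴺ adviceLength protocol x y))
  where open NProtocol π

-- A path may contain any number of queries of cost 0, so these must cost no density at all; the
-- general argument for queries would lose a factor 4.
constant-cover : ∀ {X Y} {P : Matrix X Y} → N[ P ]≤ 0 → ∃[ z ] ∀ x y → P x y ≡ z
constant-cover {P = P} (record { adviceLength = zero ; protocol = π } , computes , cost) =
  constant (π []) (cost []) λ x y → ⇔→≡ {z = true} (mk⇔
    (λ P≡true → let a , eq = Equivalence.to (computes x y) P≡true in subst (λ a → run (π a) x y ≡ true) ([]-unique a) eq)
    (λ eq → Equivalence.from (computes x y) ([] , eq)))
  where
  []-unique : (a : Vec Bool 0) → a ≡ []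
  []-unique [] = refl
  constant : ∀ ρ → height ρ ≤ 0 → (∀ x y → P x y ≡ run ρ x y) → ∃[ z ] ∀ x y → P x y ≡ z
  constant (leaf z) _ eq = z , eq
constant-cover (record { adviceLength = suc _ } , _ , cost) = contradiction (cost (replicate _ false)) λ ()

-- Cutting a subset by a predicate

∣p∩q∣+∣p∩∁q∣ : ∀ {n} (p q : Subset n) → ∣ p ∩ q ∣ + ∣ p ∩ ∁ q ∣ ≡ ∣ p ∣
∣p∩q∣+∣p∩∁q∣ []          []          = refl
∣p∩q∣+∣p∩∁q∣ (false ∷ p) (_ ∷ q)     = ∣p∩q∣+∣p∩∁q∣ p q
∣p∩q∣+∣p∩∁q∣ (true ∷ p)  (false ∷ q) = trans (+-suc _ _) (cong suc (∣p∩q∣+∣p∩∁q∣ p q))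
∣p∩q∣+∣p∩∁q∣ (true ∷ p)  (true ∷ q)  = cong suc (∣p∩q∣+∣p∩∁q∣ p q)

module _ (X : FiniteSet) where

  ⟦_⟧ : (Carrier X → Bool) → Subset (size X)
  ⟦ A ⟧ = tabulate (A ∘ Inverse.from (FiniteSet.enum X))

  lookup-⟦⟧ : ∀ A x → lookup ⟦ A ⟧ (index X x) ≡ A x
  lookup-⟦⟧ A x = trans (lookup∘tabulate _ (index X x))
                        (cong A (Inverse.strictlyInverseʳ (FiniteSet.enum X) x))

  ∈⟦⟧ : ∀ A {x} → index X x ∈ ⟦ A ⟧ → A x ≡ true
  ∈⟦⟧ A {x} x∈ = trans (sym (lookup-⟦⟧ A x)) ([]=⇒lookup x∈)

  ∈∁⟦⟧ : ∀ A {x} → index X x ∈ ∁ ⟦ A ⟧ → A x ≡ false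
  ∈∁⟦⟧ A {x} x∈ = ¬-not λ Ax → x∈∁p⇒x∉p x∈ (lookup⇒[]= _ _ (trans (lookup-⟦⟧ A x) Ax))

  -- One bit loses only a factor 2; it is charged 16, the price of a unit of oracle cost.
  at-least-half : ∀ {m n} a → m ≡ n → m ≤ a + a → n ≤ 16 * a
  at-least-half a refl m≤ = ≤-trans m≤ (+-monoʳ-≤ a (m≤m+n a _))

  larger-side : ∀ f S → ∃[ z ] Σ[ S′ ∈ Subset (size X) ] S′ ⊆ S ×
                  (∀ {x} → index X x ∈ S′ → f x ≡ z) × ∣ S ∣ ≤ 16 * ∣ S′ ∣
  larger-side f S with ≤-total (∣ S ∩ ∁ ⟦ f ⟧ ∣) (∣ S ∩ ⟦ f ⟧ ∣)
  ... | inj₁ le = true , S ∩ ⟦ f ⟧ , p∩q⊆p _ _ , (λ x∈ → ∈⟦⟧ f (proj₂ (x∈p∩q⁻ S _ x∈))) ,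
    at-least-half (∣ S ∩ ⟦ f ⟧ ∣) (∣p∩q∣+∣p∩∁q∣ S ⟦ f ⟧) (+-monoʳ-≤ ∣ S ∩ ⟦ f ⟧ ∣ le)
  ... | inj₂ le = false , S ∩ ∁ ⟦ f ⟧ , p∩q⊆p _ _ , (λ x∈ → ∈∁⟦⟧ f (proj₂ (x∈p∩q⁻ S _ x∈))) ,
    at-least-half (∣ S ∩ ∁ ⟦ f ⟧ ∣) (∣p∩q∣+∣p∩∁q∣ S ⟦ f ⟧) (+-monoˡ-≤ ∣ S ∩ ∁ ⟦ f ⟧ ∣ le)

-- Deleting a part of size at most s/K raises the number ℓ of permitted losses by one. Everything is
-- multiplied by K to stay in the naturals.
removed : ∀ K s′ ℓ {n s} (p q : Subset n) → K * ∣ p ∩ q ∣ ≤ s →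
          K * ∣ p ∩ ∁ q ∣ ≤ K * s′ + ℓ * s → K * ∣ p ∣ ≤ K * s′ + suc ℓ * s
removed K s′ ℓ {s = s} p q in≤ out≤ = begin
  K * ∣ p ∣                       ≡⟨ cong (K *_) (sym (∣p∩q∣+∣p∩∁q∣ p q)) ⟩
  K * (∣ p ∩ q ∣ + ∣ p ∩ ∁ q ∣)   ≡⟨ *-distribˡ-+ K ∣ p ∩ q ∣ _ ⟩
  K * ∣ p ∩ q ∣ + K * ∣ p ∩ ∁ q ∣ ≤⟨ +-mono-≤ in≤ out≤ ⟩
  s + (K * s′ + ℓ * s)            ≡⟨ swap s (K * s′) (ℓ * s) ⟩
  K * s′ + suc ℓ * s              ∎
  where
  open ≤-Reasoning
  swap : ∀ a b c → a + (b + c) ≡ b + (a + c)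
  swap = solve-∀

more : ∀ b ℓ s {a} → a ≤ b + ℓ * s → a ≤ b + suc ℓ * s
more b ℓ s h = ≤-trans h (+-monoʳ-≤ b (m≤n+m (ℓ * s) s))

-- Large monochromatic rectangles in oracle protocols

module _ {X Y : FiniteSet} where

  record LargeRectangle (S : Subset (size X)) (T : Subset (size Y)) (c : ℕ)
                        (F : Matrix (Carrier X) (Carrier Y)) : Set where
    constructor large
    field
      S′       : Subset (size X)
      T′       : Subset (size Y)
      S′⊆S     : S′ ⊆ S
      T′⊆T     : T′ ⊆ T
      value    : Bool
      constant : ∀ {x y} → index X x ∈ S′ → index Y y ∈ T′ → F x y ≡ value
      ratio    : ∣ S ∣ * ∣ T ∣ ≤ c * (∣ S′ ∣ * ∣ T′ ∣)

  open LargeRectangle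

  -- Inside the rectangle where the test is constant only one subtree is followed, and the losses of
  -- density multiply.
  branch : ∀ {S T c d F F₀ F₁} → LargeRectangle S T c F →
           (∀ S T → LargeRectangle S T d F₀) → (∀ S T → LargeRectangle S T d F₁) →
           LargeRectangle S T (c * d) (λ x y → if F x y then F₁ x y else F₀ x y)
  branch {S} {T} {c} {d} {F} {F₀} {F₁} R R₀ R₁ = large
    (S′ Q) (T′ Q) (S′⊆S R ∘ S′⊆S Q) (T′⊆T R ∘ T′⊆T Q) (value Q)
    (λ {x} {y} x∈ y∈ → trans (select (F x y) (constant R (S′⊆S Q x∈) (T′⊆T Q y∈))) (constant Q x∈ y∈))
    (begin
      ∣ S ∣ * ∣ T ∣                   ≤⟨ ratio R ⟩
      c * (∣ S′ R ∣ * ∣ T′ R ∣)       ≤⟨ *-monoʳ-≤ c (ratio Q) ⟩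
      c * (d * (∣ S′ Q ∣ * ∣ T′ Q ∣)) ≡⟨ sym (*-assoc c d _) ⟩
      c * d * (∣ S′ Q ∣ * ∣ T′ Q ∣)   ∎)
    where
    open ≤-Reasoning
    Q : LargeRectangle (S′ R) (T′ R) d (λ x y → if value R then F₁ x y else F₀ x y)
    Q with value R
    ... | true  = R₁ (S′ R) (T′ R)
    ... | false = R₀ (S′ R) (T′ R)
    select : ∀ b {p q} → b ≡ value R → (if b then p else q) ≡ (if value R then p else q)
    select b refl = refl

  -- Here `s` and `t` are the original side lengths, fixed while `S` and `T` shrink. Either a
  -- rectangle with sides at least s/K and t/K is found, or at most ℓ deletions were made, each of
  -- at most s/K rows or t/K columns. Fixed thresholds make the losses add up linearly.
  Swept : ℕ → ℕ → ℕ → ℕ → Matrix (Carrier X) (Carrier Y) → Subset (size X) → Subset (size Y) → Set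
  Swept K s t ℓ F S T = Σ[ S′ ∈ _ ] Σ[ T′ ∈ _ ] S′ ⊆ S × T′ ⊆ T ×
    Σ[ z ∈ Bool ] (∀ {x y} → index X x ∈ S′ → index Y y ∈ T′ → F x y ≡ z) ×
    (s ≤ K * ∣ S′ ∣ × t ≤ K * ∣ T′ ∣ ⊎
     K * ∣ S ∣ ≤ K * ∣ S′ ∣ + ℓ * s × K * ∣ T ∣ ≤ K * ∣ T′ ∣ + ℓ * t)

  sweep : ∀ K s t ℛ S T → Swept K s t (length ℛ) (covers ℛ) S T
  sweep K s t [] S T = S , T , id , id , false , (λ _ _ → refl) , inj₂ (m≤m+n _ _ , m≤m+n _ _)
  sweep K s t ((A , B) ∷ ℛ) S T with s ≤? K * ∣ S ∩ ⟦ X ⟧ A ∣ | t ≤? K * ∣ T ∩ ⟦ Y ⟧ B ∣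
  ... | yes s≤ | yes t≤ =
    S ∩ ⟦ X ⟧ A , T ∩ ⟦ Y ⟧ B , p∩q⊆p _ _ , p∩q⊆p _ _ , true ,
    (λ x∈ y∈ → cong (_∨ covers ℛ _ _)
      (cong₂ _∧_ (∈⟦⟧ X A (proj₂ (x∈p∩q⁻ S _ x∈))) (∈⟦⟧ Y B (proj₂ (x∈p∩q⁻ T _ y∈))))) ,
    inj₁ (s≤ , t≤)
  -- Once its rows are deleted, the rectangle misses what remains, so only the tail of the list
  -- matters.
  ... | no s≰ | _ = let S′ , T′ , S′⊆ , T′⊆ , z , uniform , bound = sweep K s t ℛ (S ∩ ∁ (⟦ X ⟧ A)) T in
    S′ , T′ , p∩q⊆p _ _ ∘ S′⊆ , T′⊆ , z ,
    (λ {x} {y} x∈ y∈ → trans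
      (cong (λ b → b ∧ B y ∨ covers ℛ x y) (∈∁⟦⟧ X A (proj₂ (x∈p∩q⁻ S _ (S′⊆ x∈)))))
      (uniform x∈ y∈)) ,
    map₂ (λ (bS , bT) → removed K (∣ S′ ∣) (length ℛ) S (⟦ X ⟧ A) (≰⇒≥ s≰) bS , more (K * ∣ T′ ∣) (length ℛ) t bT) bound
  ... | yes _ | no t≰ = let S′ , T′ , S′⊆ , T′⊆ , z , uniform , bound = sweep K s t ℛ S (T ∩ ∁ (⟦ Y ⟧ B)) in
    S′ , T′ , S′⊆ , p∩q⊆p _ _ ∘ T′⊆ , z ,
    (λ {x} {y} x∈ y∈ → trans
      (cong (_∨ covers ℛ x y)
        (trans (cong (A x ∧_) (∈∁⟦⟧ Y B (proj₂ (x∈p∩q⁻ T _ (T′⊆ y∈))))) (∧-zeroʳ (A x))))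
      (uniform x∈ y∈)) ,
    map₂ (λ (bS , bT) → more (K * ∣ S′ ∣) (length ℛ) s bS , removed K (∣ T′ ∣) (length ℛ) T (⟦ Y ⟧ B) (≰⇒≥ t≰) bT) bound

  oracle-rectangle : ∀ {p q} {P : Matrix (Fin p) (Fin q)} {k} (a : Carrier X → Fin p) (b : Carrier Y → Fin q) →
                     N[ P ]≤ k → ∀ S T → LargeRectangle S T (16 ^ k) (λ x y → P (a x) (b y))
  oracle-rectangle {k = zero} a b cover S T = let z , P≡z = constant-cover cover in
    large S T id id z (λ {x} {y} _ _ → P≡z (a x) (b y)) (m≤m+n _ _)
  oracle-rectangle {P = P} {k = k@(suc _)} a b cover S T =
    let ℛ , ℛ≤ , P≡ℛ = rectangle-cover cover
        S′ , T′ , S′⊆ , T′⊆ , z , uniform , bound =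
          -- With K = 2^(k+1), at most 2^k deletions of a K-th part remove at most half of each
          -- side.
          sweep (2 ^ suc k) (∣ S ∣) (∣ T ∣) (map (λ (A , B) → A ∘ a , B ∘ b) ℛ) S T
        S≤ , T≤ = large-sides (subst (_≤ 2 ^ k) (sym (length-map _ ℛ)) ℛ≤) bound
    in large S′ T′ S′⊆ T′⊆ z
         (λ {x} {y} x∈ y∈ → trans (trans (P≡ℛ (a x) (b y)) (sym (covers-map ℛ x y))) (uniform x∈ y∈))
         (begin
           ∣ S ∣ * ∣ T ∣                                  ≤⟨ *-mono-≤ S≤ T≤ ⟩
           2 ^ suc k * ∣ S′ ∣ * (2 ^ suc k * ∣ T′ ∣)      ≡⟨ swap (2 ^ suc k) (∣ S′ ∣) (∣ T′ ∣) ⟩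
           2 ^ suc k * 2 ^ suc k * (∣ S′ ∣ * ∣ T′ ∣)      ≤⟨ *-monoˡ-≤ (∣ S′ ∣ * ∣ T′ ∣) K*K≤16^k ⟩
           16 ^ k * (∣ S′ ∣ * ∣ T′ ∣)                     ∎)
    where
    open ≤-Reasoning
    covers-map : ∀ ℛ x y → covers (map (λ (A , B) → A ∘ a , B ∘ b) ℛ) x y ≡ covers ℛ (a x) (b y)
    covers-map []            x y = refl
    covers-map ((A , B) ∷ ℛ) x y = cong (A (a x) ∧ B (b y) ∨_) (covers-map ℛ x y)

    swap : ∀ c s t → c * s * (c * t) ≡ c * c * (s * t)
    swap = solve-∀

    K*K≤16^k : 2 ^ suc k * 2 ^ suc k ≤ 16 ^ k
    K*K≤16^k = begin
      2 ^ suc k * 2 ^ suc k ≡⟨ sym (^-distribʳ-* 2 2 (suc k)) ⟩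
      -- Since k ≥ 1, k + 1 ≤ 2k.
      4 ^ suc k             ≤⟨ ^-monoʳ-≤ 4 (+-monoˡ-≤ k {1} {k} (s≤s z≤n)) ⟩
      4 ^ (k + k)           ≡⟨ ^-distribˡ-+-* 4 k k ⟩
      4 ^ k * 4 ^ k         ≡⟨ sym (^-distribʳ-* 4 4 k) ⟩
      16 ^ k                ∎

    -- At least half of the side survives; this is weakened to a K-th part, to agree with the other
    -- outcome of the sweep.
    half-left : ∀ {ℓ s s′} → ℓ ≤ 2 ^ k → 2 ^ suc k * s ≤ 2 ^ suc k * s′ + ℓ * s → s ≤ 2 ^ suc k * s′
    half-left {ℓ} {s} {s′} ℓ≤ h = +-cancelˡ-≤ (2 ^ k * s) s _ (begin
      2 ^ k * s + s                 ≤⟨ +-monoʳ-≤ (2 ^ k * s) (m≤n*m s (2 ^ k) {{m^n≢0 2 k}}) ⟩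
      2 ^ k * s + 2 ^ k * s         ≡⟨ double (2 ^ k) s ⟩
      2 ^ suc k * s                 ≤⟨ h ⟩
      2 ^ suc k * s′ + ℓ * s        ≤⟨ +-monoʳ-≤ (2 ^ suc k * s′) (*-monoˡ-≤ s ℓ≤) ⟩
      2 ^ suc k * s′ + 2 ^ k * s    ≡⟨ +-comm (2 ^ suc k * s′) _ ⟩
      2 ^ k * s + 2 ^ suc k * s′    ∎)
      where
      double : ∀ c s → c * s + c * s ≡ 2 * c * s
      double = solve-∀

    large-sides : ∀ {ℓ s t s′ t′} → ℓ ≤ 2 ^ k →
      s ≤ 2 ^ suc k * s′ × t ≤ 2 ^ suc k * t′ ⊎
      2 ^ suc k * s ≤ 2 ^ suc k * s′ + ℓ * s × 2 ^ suc k * t ≤ 2 ^ suc k * t′ + ℓ * t →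
      s ≤ 2 ^ suc k * s′ × t ≤ 2 ^ suc k * t′
    large-sides ℓ≤ (inj₁ both)    = both
    large-sides ℓ≤ (inj₂ (s≤ , t≤)) = half-left ℓ≤ s≤ , half-left ℓ≤ t≤

  alice-rectangle : ∀ f S T → LargeRectangle S T 16 (λ x y → f x)
  alice-rectangle f S T = let z , S∩ , S∩⊆ , uniform , S≤ = larger-side X f S in
    large S∩ T S∩⊆ id z (λ x∈ _ → uniform x∈) (begin
      ∣ S ∣ * ∣ T ∣             ≤⟨ *-monoˡ-≤ ∣ T ∣ S≤ ⟩
      16 * ∣ S∩ ∣ * ∣ T ∣       ≡⟨ *-assoc 16 ∣ S∩ ∣ ∣ T ∣ ⟩
      16 * (∣ S∩ ∣ * ∣ T ∣)     ∎)
    where open ≤-Reasoning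

  bob-rectangle : ∀ g S T → LargeRectangle S T 16 (λ x y → g y)
  bob-rectangle g S T = let z , T∩ , T∩⊆ , uniform , T≤ = larger-side Y g T in
    large S T∩ id T∩⊆ z (λ _ y∈ → uniform y∈) (begin
      ∣ S ∣ * ∣ T ∣             ≤⟨ *-monoʳ-≤ ∣ S ∣ T≤ ⟩
      ∣ S ∣ * (16 * ∣ T∩ ∣)     ≡⟨ swap ∣ S ∣ ∣ T∩ ∣ ⟩
      16 * (∣ S ∣ * ∣ T∩ ∣)     ∎)
    where
    open ≤-Reasoning
    swap : ∀ s t → s * (16 * t) ≡ 16 * (s * t)
    swap = solve-∀

  -- Arbitrary `S` and `T` let the induction continue inside the rectangle chosen at a node.
  large-rectangle : ∀ {π d} → Costᴼ≤ π d → ∀ S T → LargeRectangle S T (16 ^ d) (runᴼ π)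
  large-rectangle {leaf z} {d} leaf S T =
    large S T id id z (λ _ _ → refl) (m≤n*m _ (16 ^ d) {{m^n≢0 16 d}})
  large-rectangle (alice {f} c₀ c₁) S T =
    branch (alice-rectangle f S T) (large-rectangle c₀) (large-rectangle c₁)
  large-rectangle (bob {g} c₀ c₁) S T =
    branch (bob-rectangle g S T) (large-rectangle c₀) (large-rectangle c₁)
  large-rectangle (oracle {P = P} {a} {b} {π₀} {π₁} {k} {d} cover c₀ c₁) S T =
    subst (λ c → LargeRectangle S T c (runᴼ (oracle P a b π₀ π₁))) (sym (^-distribˡ-+-* 16 k d))
      (branch (oracle-rectangle a b cover S T) (large-rectangle c₀) (large-rectangle c₁))

  monochromatic-rectangle : ∀ {F : Matrix (Carrier X) (Carrier Y)} {d} → Dᴺᴾ[ F ]≤ d →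
    ∃[ S ] ∃[ T ] Monochromatic X Y F S T × size X * size Y ≤ 16 ^ d * (∣ S ∣ * ∣ T ∣)
  monochromatic-rectangle {F} {d} (π , π≡F , cost) =
    S′ R , T′ R , (value R , λ x y x∈ y∈ → trans (sym (π≡F x y)) (constant R x∈ y∈)) ,
    subst (_≤ 16 ^ d * (∣ S′ R ∣ * ∣ T′ R ∣)) (cong₂ _*_ (∣⊤∣≡n (size X)) (∣⊤∣≡n (size Y))) (ratio R)
    where R = large-rectangle cost ⊤ ⊤

-- From small rectangles to oracle cost

-- A rectangle of density at least 16^(-d) exists, while 2^n times the K-th power of its density is
-- at most 1. The matrix is nonempty, so the area `v` is positive and cancels.
Dᴺᴾ-lower-bound : ∀ {X Y} {F : Matrix (Carrier X) (Carrier Y)} {n K d} →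
                  .{{NonZero (size X * size Y)}} →
                  2^[ n / K ]≤rect⁻¹ {X} {Y} F → Dᴺᴾ[ F ]≤ d → n ≤ 4 * K * d
Dᴺᴾ-lower-bound {X} {Y} {F} {n} {K} {d} small D with monochromatic-rectangle {X} {Y} D
... | S , T , mono , big = 2^m≤2^n⇒m≤n (*-cancelʳ-≤ _ _ (v ^ K) {{m^n≢0 v K {{v≢0}}}} (begin
  2 ^ n * v ^ K               ≤⟨ small S T mono ⟩
  (size X * size Y) ^ K       ≤⟨ ^-monoˡ-≤ K big ⟩
  (16 ^ d * v) ^ K            ≡⟨ ^-distribʳ-* (16 ^ d) v K ⟩
  (16 ^ d) ^ K * v ^ K        ≡⟨ cong (_* v ^ K) 16^d^K ⟩
  2 ^ (4 * K * d) * v ^ K     ∎))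
  where
  open ≤-Reasoning
  v : ℕ
  v = ∣ S ∣ * ∣ T ∣
  v≢0 : NonZero v
  v≢0 = ≢-nonZero λ v≡0 → ≢-nonZero⁻¹ (size X * size Y)
    (n≤0⇒n≡0 (subst (size X * size Y ≤_) (trans (cong (16 ^ d *_) v≡0) (*-zeroʳ (16 ^ d))) big))
  16^d^K : (16 ^ d) ^ K ≡ 2 ^ (4 * K * d)
  16^d^K = trans (^-*-assoc 16 d K) (trans (^-*-assoc 2 4 (d * K)) (cong (2 ^_) (swap d K)))
    where
    swap : ∀ d K → 4 * (d * K) ≡ 4 * K * d
    swap = solve-∀
  2^m≤2^n⇒m≤n : ∀ {m n} → 2 ^ m ≤ 2 ^ n → m ≤ n
  2^m≤2^n⇒m≤n le = ≮⇒≥ λ n<m → <⇒≱ (^-monoʳ-< 2 (s≤s (s≤s z≤n)) n<m) le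

-- Separation of the classes

PP-mono : ∀ {X Y} {F : Matrix X Y} {b b′} → b ≤ b′ → PP[ F ]≤ b → PP[ F ]≤ b′
PP-mono b≤b′ (ε , c , m , ε<½ , R , adv , c+m≤b) = ε , c , m , ε<½ , R , adv , ≤-trans c+m≤b b≤b′

majority-Dᴺᴾ : ∀ n d → Dᴺᴾ[ majority n ]≤ d → n ≤ 16 * d
majority-Dᴺᴾ n d = Dᴺᴾ-lower-bound {Bits n} {Bits n} {n = n} {K = 4} {d}
  {{m*n≢0 (2 ^ n) (2 ^ n) {{m^n≢0 2 n}} {{m^n≢0 2 n}}}} (majority-rect n)

majority-problem : ∀ n → Problem n
majority-problem n = record
  { X      = Bits n
  ; Y      = Bits n
  ; matrix = majority n
  ; n-bit  = trans (cong ⌈log₂_⌉ (⊔-idem (2 ^ n))) (⌈log₂2^n⌉≡n n)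
  }

n<2^n : ∀ n → n < 2 ^ n
n<2^n zero    = s≤s z≤n
n<2^n (suc n) = begin-strict
  suc n           <⟨ s≤s (n<2^n n) ⟩
  1 + 2 ^ n       ≤⟨ +-monoˡ-≤ (2 ^ n) (m^n>0 2 n) ⟩
  2 ^ n + 2 ^ n   ≡⟨ cong (2 ^ n +_) (sym (+-identityʳ (2 ^ n))) ⟩
  2 ^ suc n       ∎
  where open ≤-Reasoning

linear<exponential : ∀ a k → ∃[ s ] a + s * k < 2 ^ s
-- For r = 2k + a, 2^(2r) ≥ (r+1)², and the term r² = r(2k + a) already supplies 2rk.
linear<exponential a k = r + r , (begin
  suc (a + (r + r) * k)                                          ≤⟨ m≤m+n _ _ ⟩
  suc (a + (r + r) * k) + (r * a + r + 2 * k)                    ≡⟨ square a k ⟩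
  suc r * suc r                                                  ≤⟨ *-mono-≤ (n<2^n r) (n<2^n r) ⟩
  2 ^ r * 2 ^ r                                                  ≡⟨ ^-distribˡ-+-* 2 r r ⟨
  2 ^ (r + r)                                                    ∎)
  where
  open ≤-Reasoning
  r : ℕ
  r = 2 * k + a
  square : ∀ a k → suc (a + ((2 * k + a) + (2 * k + a)) * k) + ((2 * k + a) * a + (2 * k + a) + 2 * k)
                   ≡ suc (2 * k + a) * suc (2 * k + a)
  square = solve-∀

-- For n = 2^(2^s) the logarithm is 2^s, and comparing exponents leaves A + sk < 2^s. The nonzero
-- logarithm later absorbs an additive constant.
polylog<linear : ∀ A k → ∃[ n ] NonZero ⌊log₂ n ⌋ × A * ⌊log₂ n ⌋ ^ k < n
polylog<linear A k with linear<exponential A k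
... | s , exponent< = 2 ^ l , subst NonZero (sym (⌊log₂[2^n]⌋≡n l)) (m^n≢0 2 s) , (begin-strict
  A * ⌊log₂ 2 ^ l ⌋ ^ k    ≡⟨ cong (λ t → A * t ^ k) (⌊log₂[2^n]⌋≡n l) ⟩
  A * l ^ k                ≤⟨ *-monoˡ-≤ (l ^ k) (<⇒≤ (n<2^n A)) ⟩
  2 ^ A * l ^ k            ≡⟨ cong (2 ^ A *_) (^-*-assoc 2 s k) ⟩
  2 ^ A * 2 ^ (s * k)      ≡⟨ ^-distribˡ-+-* 2 A (s * k) ⟨
  2 ^ (A + s * k)          <⟨ ^-monoʳ-< 2 (s≤s (s≤s z≤n)) exponent< ⟩
  2 ^ l                    ∎)
  where
  open ≤-Reasoning
  l : ℕ
  l = 2 ^ s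

majority∈PP : ClassPP majority-problem
majority∈PP = (λ n → 6 + ⌊log₂ n ⌋) , (6 , 1 , λ n → bound ⌊log₂ n ⌋) , majority-PP
  where
  bound : ∀ l → 6 + l ≤ 6 * l ^ 1 + 6
  bound l = begin
    6 + l         ≡⟨ +-comm 6 l ⟩
    l + 6         ≤⟨ +-monoˡ-≤ 6 (m≤n*m l 6) ⟩
    6 * l + 6     ≡⟨ cong (λ t → 6 * t + 6) (^-identityʳ l) ⟨
    6 * l ^ 1 + 6 ∎
    where open ≤-Reasoning

ClassPP⊈ClassPᴺᴾ : ClassPP ⊈ ClassPᴺᴾ
ClassPP⊈ClassPᴺᴾ PP⊆Pᴺᴾ =
  let f , (C , k , f≤) , D = PP⊆Pᴺᴾ {majority-problem} majority∈PP
      n , log≢0 , <n = polylog<linear (16 * (C + C)) k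
  in <⇒≱ <n (begin
    n                                  ≤⟨ majority-Dᴺᴾ n (f n) (D n) ⟩
    16 * f n                           ≤⟨ *-monoʳ-≤ 16 (f≤ n) ⟩
    16 * (C * ⌊log₂ n ⌋ ^ k + C)       ≤⟨ *-monoʳ-≤ 16 (absorb C (⌊log₂ n ⌋ ^ k) {{m^n≢0 ⌊log₂ n ⌋ k {{log≢0}}}}) ⟩
    16 * ((C + C) * ⌊log₂ n ⌋ ^ k)     ≡⟨ *-assoc 16 (C + C) _ ⟨
    16 * (C + C) * ⌊log₂ n ⌋ ^ k       ∎)
  where
  open ≤-Reasoning
  absorb : ∀ C t .{{_ : NonZero t}} → C * t + C ≤ (C + C) * t
  absorb C t = begin
    C * t + C     ≤⟨ +-monoʳ-≤ (C * t) (m≤m*n C t) ⟩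
    C * t + C * t ≡⟨ *-distribʳ-+ t C C ⟨
    (C + C) * t   ∎

theorem5p19 : (Σ[ F ∈ (∀ n → Matrix (Vec Bool n) (Vec Bool n)) ]
    (∃[ C ] ∃[ n₀ ] ∀ n → n₀ ≤ n → PP[ F n ]≤ (C * ⌊log₂ n ⌋)) ×
    (∃[ K ] ∃[ n₀ ] ∀ n → n₀ ≤ n → 2^[ n / K ]≤rect⁻¹ {Bits n} {Bits n} (F n)) ×
    (∃[ C ] ∃[ n₀ ] ∀ n → n₀ ≤ n → ∀ d → Dᴺᴾ[ F n ]≤ d → n ≤ C * d)) ×
    (ClassPP ⊈ ClassPᴺᴾ)
theorem5p19 =
  ( majority
  -- From n = 2 on the logarithm is at least 1, so the constant 6 is at most 6⌊log₂ n⌋.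
  , (7 , 2 , λ n 2≤n → PP-mono (6+l≤7l n 2≤n) (majority-PP n))
  , (4 , 0 , λ n _ → majority-rect n)
  , (16 , 0 , λ n _ → majority-Dᴺᴾ n)
  ) , ClassPP⊈ClassPᴺᴾ
  where
  6+l≤7l : ∀ n → 2 ≤ n → 6 + ⌊log₂ n ⌋ ≤ 7 * ⌊log₂ n ⌋
  6+l≤7l n 2≤n = begin
    6 + l     ≤⟨ +-monoˡ-≤ l (*-monoʳ-≤ 6 (⌊log₂⌋-mono-≤ 2≤n)) ⟩
    6 * l + l ≡⟨ +-comm (6 * l) l ⟩
    7 * l     ∎
    where
    open ≤-Reasoning
    l : ℕ
    l = ⌊log₂ n ⌋
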